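{- Let $\Sigma_1,\Sigma_2$ be signatures, let $M_1$ be a $\Sigma_1$-model and $M_2$ a $\Sigma_2$-model, and let $\Gamma_1$, $\Gamma_2$ be theories over $\Sigma_1$ and $\Sigma_2$ respectively. Suppose $M_1$ and $M_2$ are gluable. If $M_1\models\Gamma_1$ and $M_2\models\Gamma_2$, then the glued model satisfies the merged theory: $\mathit{glueM}(M_1,M_2)\models \mathit{combineT}(\Gamma_1,\Gamma_2)$.
   Context: **Isomorphisms.** An isomorphism $A\cong B$ of types is a pair of mutually inverse functions. A partial isomorphism $\mathrm{Partial}(A,B)$ consists of functions $to:A\to B$ and $from:B\to \mathrm{Option}(A)$ with $from(to(x))=\mathrm{Some}(x)$ for all $x$, and $from(x)=\mathrm{Some}(y)\Rightarrow to(y)=x$ for all $x,y$. **Signatures.** A signature $\Sigma$ consists of: a type $Sorts$; for each sort $s$ infinite types $EV_s$ (element variables) and $SV_s$ (set variables); a type $Symb$ of symbols; functions $params:Symb\to \mathrm{List}(Sorts)$ and $return:Symb\to Sorts$. **Patterns.** (Locally nameless, intrinsically sorted and scoped.) For lists of sorts $ex,mu$ and a sort $s$, the type $\mathrm{Pattern}(\Sigma,ex,mu,s)$ is inductively generated by: free element variables $\hat x$ ($x\in EV_s$); free set variables $\hat{\hat X}$ ($X\in SV_s$); bound element variables $\underline n$, where $n$ is a position (de Bruijn index) in $ex$ holding the sort $s$; bound set variables $\underline{\underline N}$, where $N$ is a position in $mu$ holding the sort $s$; applications $\sigma\cdot\langle\varphi_1,\dots,\varphi_n\rangle$ when $return(\sigma)=s$,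 $params(\sigma)=[s_1,\dots,s_n]$ and $\varphi_i\in\mathrm{Pattern}(\Sigma,ex,mu,s_i)$; $\neg\varphi$ and $\varphi_1\wedge\varphi_2$ of the same sort and environments; $\exists_{s'}.\varphi$ with $\varphi\in\mathrm{Pattern}(\Sigma,s'::ex,mu,s)$; $\mu.\varphi$ with $\varphi\in\mathrm{Pattern}(\Sigma,ex,s::mu,s)$. No positivity condition is imposed on $\mu$. A theory over $\Sigma$ is a set of pairs $(s,\varphi)$ with $\varphi\in\mathrm{Pattern}(\Sigma,[],[],s)$ (a closed pattern of sort $s$). **Models.** A $\Sigma$-model $M$ gives, for each sort $s$, a nonempty type $carrier(M,s)=M_s$ and, for each symbol $\sigma$ with $params(\sigma)=[s_1,\dots,s_n]$, $return(\sigma)=s$, a function $app(M,\sigma):M_{s_1}\times\dots\times M_{s_n}\to\mathcal P(M_s)$, extended to subsets by $app(M,\sigma)(A_1,\dots,A_n)=\bigcup_{a_i\in A_i}app(M,\sigma)(a_1,\dots,a_n)$. A valuation $\rho$ assigns to each $x\in EV_s$ an element of $M_s$ and to each $X\in SV_s$ a subset of $M_s$. Patterns of sort $s$ are interpreted as subsets of $M_s$: $\bar\rho(\hat x)=\{\rho(x)\}$; $\bar\rho(\hat{\hat X})=\rho(X)$; bound (dangling) variables give $\emptyset$; $\bar\rho(\neg\varphi)=M_s\setminus\bar\rho(\varphi)$; $\bar\rho(\varphi\wedge\psi)=\bar\rho(\varphi)\cap\bar\rho(\psi)$; $\bar\rho(\sigma\cdot\langle\varphi_i\rangle)=app(M,\sigma)(\bar\rho(\varphi_1),\dots,\bar\rho(\varphi_n))$;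 $\bar\rho(\exists_{s'}.\varphi)=\bigcup_{m\in M_{s'}}\overline{\rho[x\mapsto m]}(\varphi')$, where $x\in EV_{s'}$ is fresh for $\varphi$ and $\varphi'$ is $\varphi$ with the outermost bound element variable replaced by $\hat x$; $\bar\rho(\mu.\varphi)$ is the intersection of all $A\subseteq M_s$ with $\overline{\rho[X\mapsto A]}(\varphi')\subseteq A$, where $X\in SV_s$ is fresh for $\varphi$ and $\varphi'$ is $\varphi$ with the outermost bound set variable replaced by $\hat{\hat X}$. $M\models\Gamma$ means that $\bar\rho(\varphi)=M_s$ for every $(s,\varphi)\in\Gamma$ and every valuation $\rho$. **Combinable signatures.** $\Sigma_1,\Sigma_2$ are combinable if there are given: a type $U$ (united sorts) with partial isomorphisms $p_i:\mathrm{Partial}(Sorts_{\Sigma_i},U)$, $i=1,2$, such that every $s\in U$ has $p_1.from(s)$ or $p_2.from(s)$ of the form $\mathrm{Some}(\cdot)$; a type $V$ (united symbols) with partial isomorphisms $q_i:\mathrm{Partial}(Symb_{\Sigma_i},V)$ with the analogous no-junk property; and agreement: whenever $p_1.from(s)=\mathrm{Some}(s_1)$ and $p_2.from(s)=\mathrm{Some}(s_2)$, isomorphisms $EV_{\Sigma_1,s_1}\cong EV_{\Sigma_2,s_2}$ and $SV_{\Sigma_1,s_1}\cong SV_{\Sigma_2,s_2}$; whenever $q_1.from(\sigma)=\mathrm{Some}(\sigma_1)$ and $q_2.from(\sigma)=\mathrm{Some}(\sigma_2)$, $\mathrm{map}(p_1.to)(params(\sigma_1))=\mathrm{map}(p_2.to)(params(\sigma_2))$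 and $p_1.to(return(\sigma_1))=p_2.to(return(\sigma_2))$. **Combined signature** $\mathit{combine}(\Sigma_1,\Sigma_2)$: sorts $U$, symbols $V$; $EV_s$ is $EV_{\Sigma_1,s'}$ if $p_1.from(s)=\mathrm{Some}(s')$, otherwise $EV_{\Sigma_2,s'}$ with $p_2.from(s)=\mathrm{Some}(s')$; likewise $SV_s$; $params(\sigma)=\mathrm{map}(p_1.to)(params(\sigma'))$ and $return(\sigma)=p_1.to(return(\sigma'))$ if $q_1.from(\sigma)=\mathrm{Some}(\sigma')$, otherwise the same with $p_2,q_2,\Sigma_2$. **Gluable models.** $M_1,M_2$ are gluable if $\Sigma_1,\Sigma_2$ are combinable (with given united sorts $U$, united symbols $V$, partial isomorphisms $p_i:\mathrm{Partial}(Sorts_{\Sigma_i},U)$ and $q_i:\mathrm{Partial}(Symb_{\Sigma_i},V)$ for $i=1,2$, and isomorphisms of the variable types at shared sorts, satisfying the no-junk and agreement conditions of combinability), whenever $p_1.from(s)=\mathrm{Some}(s_1)$ and $p_2.from(s)=\mathrm{Some}(s_2)$ an isomorphism $carrier(M_1,s_1)\cong carrier(M_2,s_2)$ is given, and whenever $q_1.from(\sigma)=\mathrm{Some}(\sigma_1)$ and $q_2.from(\sigma)=\mathrm{Some}(\sigma_2)$, $app(M_1,\sigma_1)$ and $app(M_2,\sigma_2)$ agree on all arguments when arguments and result sets are converted along these carrier isomorphisms. **Glued model** $\mathit{glueM}(M_1,M_2)$, over $\mathit{combine}(\Sigma_1,\Sigma_2)$: $carrier(s)=carrier(M_1,s')$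 if $p_1.from(s)=\mathrm{Some}(s')$, otherwise $carrier(M_2,s')$ with $p_2.from(s)=\mathrm{Some}(s')$; $app(\sigma)=app(M_1,\sigma')$ if $q_1.from(\sigma)=\mathrm{Some}(\sigma')$, otherwise $app(M_2,\sigma')$ with $q_2.from(\sigma)=\mathrm{Some}(\sigma')$ (arguments and results being converted along the carrier isomorphisms at shared sorts where necessary). **Lifting and merged theory.** For $i=1,2$, $\mathit{lift}$ maps $\mathrm{Pattern}(\Sigma_i,ex,mu,s)$ to $\mathrm{Pattern}(\mathit{combine}(\Sigma_1,\Sigma_2),\mathrm{map}(p_i.to)(ex),\mathrm{map}(p_i.to)(mu),p_i.to(s))$ by structural recursion: it keeps all connectives and de Bruijn positions, replaces each symbol $\sigma$ by $q_i.to(\sigma)$, each $\exists_{s'}$ by $\exists_{p_i.to(s')}$, and keeps free variables (converted along the given variable isomorphism when the combined signature uses the other signature's variables at a shared sort). Then $\mathit{combineT}(\Gamma_1,\Gamma_2)=\{(p_1.to(s),\mathit{lift}(\varphi)) : (s,\varphi)\in\Gamma_1\}\cup\{(p_2.to(s),\mathit{lift}(\varphi)) : (s,\varphi)\in\Gamma_2\}$. -}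

module Defs where

open import Axiom.ExcludedMiddle using (ExcludedMiddle)
open import Data.List using (List; []; _∷_; _++_; map)
open import Data.List.Membership.Propositional using (_∈_; _∉_)
open import Data.List.Membership.Propositional.Properties using (∈-map⁺)
open import Data.List.Properties using (∷-injectiveˡ; ∷-injectiveʳ)
open import Data.List.Relation.Unary.All as All using (All; []; _∷_)
open import Data.List.Relation.Unary.All.Properties using (map⁻)
open import Data.List.Relation.Unary.Any using (here; there)
open import Data.Maybe using (Maybe; just; nothing)
open import Data.Maybe.Properties using (just-injective)
open import Data.Nat using (ℕ; suc; _+_; _<_; s≤s)
open import Data.Nat.Induction using (Acc; acc; <-wellFounded)
open import Data.Nat.Properties using (m≤m+n; m≤n+m; ≤-refl; ≤-reflexive)
open import Data.Product using (Σ; ∃; _×_; _,_; proj₁; proj₂)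
open import Data.Sum using (_⊎_; inj₁; inj₂; map₁)
open import Data.Unit.Polymorphic using (⊤; tt)
open import Function using (_∘_; _↔_; Inverse)
open import Function.Properties.Inverse using (↔-refl)
open import Level using (Level; Lift; lift; lower) renaming (suc to lsuc)
open import Relation.Binary.Definitions using (DecidableEquality)
open import Relation.Binary.PropositionalEquality
  using (_≡_; refl; sym; trans; cong; cong₂)
open import Relation.Nullary using (yes; no)
open import Relation.Nullary.Decidable using (True; map′)
open import Relation.Unary using (Pred; _⊆_; _≐_; _⊢_; ∁; _∩_; _∪_; ｛_｝; ⋃; ⋂)
  renaming (_∈_ to _∈ᴾ_)
open import Relation.Unary.Polymorphic using (∅; U)

private
  variable
    ℓ : Level

------------------------------------------------------------------------
-- Partial isomorphisms and signatures

record Partial (A B : Set ℓ) : Set ℓ where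
  field
    to      : A → B
    from    : B → Maybe A
    from-to : ∀ x → from (to x) ≡ just x
    to-from : ∀ {x y} → from x ≡ just y → to y ≡ x

-- A type is infinite when no finite list exhausts it; the witnesses are
-- the fresh names used in the semantics of the binders.
Infinite : Set ℓ → Set ℓ
Infinite A = (xs : List A) → ∃ λ x → x ∉ xs

record Signature (ℓ : Level) : Set (lsuc ℓ) where
  field
    Sorts       : Set ℓ
    EV SV       : Sorts → Set ℓ
    EV-infinite : ∀ s → Infinite (EV s)
    SV-infinite : ∀ s → Infinite (SV s)
    Symb        : Set ℓ
    params      : Symb → List Sorts
    return      : Symb → Sorts

open Signature

------------------------------------------------------------------------
-- Patterns

-- A de Bruijn index is a proof that the sort occurs in the environment.
data Pattern (S : Signature ℓ) (ex mu : List (Sorts S)) (s : Sorts S) : Set ℓ where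
  evar   : EV S s → Pattern S ex mu s
  svar   : SV S s → Pattern S ex mu s
  ebound : s ∈ ex → Pattern S ex mu s
  sbound : s ∈ mu → Pattern S ex mu s
  app    : ∀ σ {ss} → params S σ ≡ ss → return S σ ≡ s →
           All (Pattern S ex mu) ss → Pattern S ex mu s
  neg    : Pattern S ex mu s → Pattern S ex mu s
  and    : Pattern S ex mu s → Pattern S ex mu s → Pattern S ex mu s
  exists : ∀ s′ → Pattern S (s′ ∷ ex) mu s → Pattern S ex mu s
  fix    : Pattern S ex (s ∷ mu) s → Pattern S ex mu s

Theory : Signature ℓ → Set (lsuc ℓ)
Theory {ℓ} S = Pred (∃ (Pattern S [] [])) ℓ

-- Each bound index is either renamed or instantiated by a free variable.
Inst : ∀ {A : Set ℓ} → (A → Set ℓ) → List A → List A → Set ℓ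
Inst V Γ Δ = ∀ {s} → s ∈ Γ → s ∈ Δ ⊎ V s

liftInst : ∀ {A : Set ℓ} {V : A → Set ℓ} {Γ Δ t} → Inst V Γ Δ → Inst V (t ∷ Γ) (t ∷ Δ)
liftInst θ (here e)  = inj₁ (here e)
liftInst θ (there i) = map₁ there (θ i)

outermost : ∀ {A : Set ℓ} {V : A → Set ℓ} {Γ t} → V t → Inst V (t ∷ Γ) Γ
outermost x (here refl) = inj₂ x
outermost x (there i)   = inj₁ i

module _ {S : Signature ℓ} where

  mutual
    inst : ∀ {ex ex′ mu mu′ s} → Inst (EV S) ex ex′ → Inst (SV S) mu mu′ →
           Pattern S ex mu s → Pattern S ex′ mu′ s
    inst ε τ (evar x)       = evar x
    inst ε τ (svar X)       = svar X
    inst ε τ (ebound i) with ε i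
    ... | inj₁ j            = ebound j
    ... | inj₂ x            = evar x
    inst ε τ (sbound i) with τ i
    ... | inj₁ j            = sbound j
    ... | inj₂ X            = svar X
    inst ε τ (app σ p r φs) = app σ p r (insts ε τ φs)
    inst ε τ (neg φ)        = neg (inst ε τ φ)
    inst ε τ (and φ ψ)      = and (inst ε τ φ) (inst ε τ ψ)
    inst ε τ (exists s′ φ)  = exists s′ (inst (liftInst ε) τ φ)
    inst ε τ (fix φ)        = fix (inst ε (liftInst τ) φ)

    insts : ∀ {ex ex′ mu mu′ ss} → Inst (EV S) ex ex′ → Inst (SV S) mu mu′ →
            All (Pattern S ex mu) ss → All (Pattern S ex′ mu′) ss
    insts ε τ []       = []
    insts ε τ (φ ∷ φs) = inst ε τ φ ∷ insts ε τ φs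

  openᵉ : ∀ {ex mu s s′} → EV S s′ → Pattern S (s′ ∷ ex) mu s → Pattern S ex mu s
  openᵉ x = inst (outermost x) inj₁

  openˢ : ∀ {ex mu s s′} → SV S s′ → Pattern S ex (s′ ∷ mu) s → Pattern S ex mu s
  openˢ X = inst inj₁ (outermost X)

  mutual
    size : ∀ {ex mu s} → Pattern S ex mu s → ℕ
    size (evar x)       = 0
    size (svar X)       = 0
    size (ebound i)     = 0
    size (sbound i)     = 0
    size (app σ p r φs) = suc (sizes φs)
    size (neg φ)        = suc (size φ)
    size (and φ ψ)      = suc (size φ + size ψ)
    size (exists s′ φ)  = suc (size φ)
    size (fix φ)        = suc (size φ)

    sizes : ∀ {ex mu ss} → All (Pattern S ex mu) ss → ℕ
    sizes []       = 0
    sizes (φ ∷ φs) = suc (size φ + sizes φs)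

  mutual
    size-inst : ∀ {ex ex′ mu mu′ s} (ε : Inst (EV S) ex ex′) (τ : Inst (SV S) mu mu′)
                (φ : Pattern S ex mu s) → size (inst ε τ φ) ≡ size φ
    size-inst ε τ (evar x)       = refl
    size-inst ε τ (svar X)       = refl
    size-inst ε τ (ebound i) with ε i
    ... | inj₁ j                 = refl
    ... | inj₂ x                 = refl
    size-inst ε τ (sbound i) with τ i
    ... | inj₁ j                 = refl
    ... | inj₂ X                 = refl
    size-inst ε τ (app σ p r φs) = cong suc (sizes-insts ε τ φs)
    size-inst ε τ (neg φ)        = cong suc (size-inst ε τ φ)
    size-inst ε τ (and φ ψ)      = cong suc (cong₂ _+_ (size-inst ε τ φ) (size-inst ε τ ψ))
    size-inst ε τ (exists s′ φ)  = cong suc (size-inst (liftInst ε) τ φ)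
    size-inst ε τ (fix φ)        = cong suc (size-inst ε (liftInst τ) φ)

    sizes-insts : ∀ {ex ex′ mu mu′ ss} (ε : Inst (EV S) ex ex′) (τ : Inst (SV S) mu mu′)
                  (φs : All (Pattern S ex mu) ss) → sizes (insts ε τ φs) ≡ sizes φs
    sizes-insts ε τ []       = refl
    sizes-insts ε τ (φ ∷ φs) = cong suc (cong₂ _+_ (size-inst ε τ φ) (sizes-insts ε τ φs))

------------------------------------------------------------------------
-- Models

record Model (S : Signature ℓ) : Set (lsuc ℓ) where
  field
    Carrier  : Sorts S → Set ℓ
    nonempty : ∀ s → Carrier s
    appᴹ     : ∀ σ → All Carrier (params S σ) → Pred (Carrier (return S σ)) ℓ

open Model

_∈*_ : ∀ {A : Set ℓ} {C : A → Set ℓ} {ss} →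
       All C ss → All (λ s → Pred (C s) ℓ) ss → Set ℓ
[]       ∈* []       = ⊤
(a ∷ as) ∈* (P ∷ Ps) = a ∈ᴾ P × as ∈* Ps

appᴾ : ∀ {S : Signature ℓ} (M : Model S) σ →
       All (λ s → Pred (Carrier M s) ℓ) (params S σ) → Pred (Carrier M (return S σ)) ℓ
appᴾ M σ As = ⋃ (∃ λ as → as ∈* As) λ (as , _) → appᴹ M σ as

record Valuation {S : Signature ℓ} (M : Model S) : Set (lsuc ℓ) where
  field
    evalᵉ : ∀ {s} → EV S s → Carrier M s
    evalˢ : ∀ {s} → SV S s → Pred (Carrier M s) ℓ

open Valuation

-- Excluded middle decides equality of sorts and variables, and brings the
-- intersection in the semantics of fix, which quantifies over all subsets,
-- back to the level of subsets.
module Semantics {ℓ : Level} (em : ExcludedMiddle (lsuc ℓ)) where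

  _≟_ : {A : Set ℓ} → DecidableEquality A
  x ≟ y = map′ lower lift (em {P = Lift (lsuc ℓ) (x ≡ y)})

  resize : {A : Set ℓ} → Pred A (lsuc ℓ) → Pred A ℓ
  resize P x = Lift ℓ (True (em {P = P x}))

  module _ {S : Signature ℓ} where

    mutual
      freeᵉ : ∀ {ex mu t} s → Pattern S ex mu t → List (EV S s)
      freeᵉ {t = t} s (evar x) with t ≟ s
      ... | yes refl           = x ∷ []
      ... | no _               = []
      freeᵉ s (svar X)         = []
      freeᵉ s (ebound i)       = []
      freeᵉ s (sbound i)       = []
      freeᵉ s (app σ p r φs)   = freesᵉ s φs
      freeᵉ s (neg φ)          = freeᵉ s φ
      freeᵉ s (and φ ψ)        = freeᵉ s φ ++ freeᵉ s ψ
      freeᵉ s (exists s′ φ)    = freeᵉ s φ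
      freeᵉ s (fix φ)          = freeᵉ s φ

      freesᵉ : ∀ {ex mu ts} s → All (Pattern S ex mu) ts → List (EV S s)
      freesᵉ s []       = []
      freesᵉ s (φ ∷ φs) = freeᵉ s φ ++ freesᵉ s φs

    mutual
      freeˢ : ∀ {ex mu t} s → Pattern S ex mu t → List (SV S s)
      freeˢ s (evar x)         = []
      freeˢ {t = t} s (svar X) with t ≟ s
      ... | yes refl           = X ∷ []
      ... | no _               = []
      freeˢ s (ebound i)       = []
      freeˢ s (sbound i)       = []
      freeˢ s (app σ p r φs)   = freesˢ s φs
      freeˢ s (neg φ)          = freeˢ s φ
      freeˢ s (and φ ψ)        = freeˢ s φ ++ freeˢ s ψ
      freeˢ s (exists s′ φ)    = freeˢ s φ
      freeˢ s (fix φ)          = freeˢ s φ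

      freesˢ : ∀ {ex mu ts} s → All (Pattern S ex mu) ts → List (SV S s)
      freesˢ s []       = []
      freesˢ s (φ ∷ φs) = freeˢ s φ ++ freesˢ s φs

    freshᵉ : ∀ {ex mu t} s → Pattern S ex mu t → EV S s
    freshᵉ s φ = proj₁ (EV-infinite S s (freeᵉ s φ))

    freshˢ : ∀ {ex mu t} s → Pattern S ex mu t → SV S s
    freshˢ s φ = proj₁ (SV-infinite S s (freeˢ s φ))

    module _ {M : Model S} where

      -- Names of different sorts are compared as pairs of a sort and a name.
      _[_↦_]ᵉ : ∀ {s} → Valuation M → EV S s → Carrier M s → Valuation M
      evalᵉ (_[_↦_]ᵉ {s} ρ x m) {t} y with _≟_ {A = ∃ (EV S)} (s , x) (t , y)
      ... | yes refl = m
      ... | no _     = evalᵉ ρ y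
      evalˢ (ρ [ x ↦ m ]ᵉ) = evalˢ ρ

      _[_↦_]ˢ : ∀ {s} → Valuation M → SV S s → Pred (Carrier M s) ℓ → Valuation M
      evalᵉ (ρ [ X ↦ A ]ˢ) = evalᵉ ρ
      evalˢ (_[_↦_]ˢ {s} ρ X A) {t} Y with _≟_ {A = ∃ (SV S)} (s , X) (t , Y)
      ... | yes refl = A
      ... | no _     = evalˢ ρ Y

    -- Opening a binder is not structurally smaller, so the recursion is on size.
    module _ (M : Model S) where

      mutual
        interp : ∀ {ex mu s} (φ : Pattern S ex mu s) → Acc _<_ (size φ) →
                 Valuation M → Pred (Carrier M s) ℓ
        interp (evar x)            _        ρ = ｛ evalᵉ ρ x ｝
        interp (svar X)            _        ρ = evalˢ ρ X
        interp (ebound i)          _        ρ = ∅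
        interp (sbound i)          _        ρ = ∅
        interp (app σ refl refl φs) (acc rs) ρ =
          appᴾ M σ (interps φs (rs ≤-refl) ρ)
        interp (neg φ)             (acc rs) ρ = ∁ (interp φ (rs ≤-refl) ρ)
        interp (and φ ψ)           (acc rs) ρ =
          interp φ (rs (s≤s (m≤m+n _ _))) ρ ∩ interp ψ (rs (s≤s (m≤n+m _ (size φ)))) ρ
        interp (exists s′ φ)       (acc rs) ρ =
          let x = freshᵉ s′ φ in
          ⋃ (Carrier M s′) λ m →
            interp (openᵉ x φ) (rs (s≤s (≤-reflexive (size-inst _ _ φ)))) (ρ [ x ↦ m ]ᵉ)
        interp {s = s} (fix φ)     (acc rs) ρ =
          let X   = freshˢ s φ
              F A = interp (openˢ X φ) (rs (s≤s (≤-reflexive (size-inst _ _ φ)))) (ρ [ X ↦ A ]ˢ)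
          in resize (⋂ (Σ (Pred (Carrier M s) ℓ) λ A → F A ⊆ A) proj₁)

        interps : ∀ {ex mu ss} (φs : All (Pattern S ex mu) ss) → Acc _<_ (sizes φs) →
                  Valuation M → All (λ s → Pred (Carrier M s) ℓ) ss
        interps []       _        ρ = []
        interps (φ ∷ φs) (acc rs) ρ =
          interp φ (rs (s≤s (m≤m+n _ _))) ρ ∷ interps φs (rs (s≤s (m≤n+m _ (size φ)))) ρ

      ⟦_⟧ : ∀ {ex mu s} → Pattern S ex mu s → Valuation M → Pred (Carrier M s) ℓ
      ⟦ φ ⟧ = interp φ (<-wellFounded (size φ))

      infix 4 _⊨_

      _⊨_ : Theory S → Set (lsuc ℓ)
      _⊨_ Γ = ∀ {s φ} → (s , φ) ∈ᴾ Γ → ∀ ρ → ⟦ φ ⟧ ρ ≐ U {ℓ = ℓ}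

------------------------------------------------------------------------
-- Combining two types along partial isomorphisms

open Partial

module _ {A B W : Set ℓ} (p₁ : Partial A W) (p₂ : Partial B W) where

  NoJunk : Set ℓ
  NoJunk = ∀ w → (∃ λ a → from p₁ w ≡ just a) ⊎ (∃ λ b → from p₂ w ≡ just b)

  -- The side that supplies the data at w; the first one has priority.
  data Origin (w : W) : Set ℓ where
    fst : ∀ a → from p₁ w ≡ just a → Origin w
    snd : ∀ b → from p₁ w ≡ nothing → from p₂ w ≡ just b → Origin w

  origin : NoJunk → ∀ w → Origin w
  origin nj w with from p₁ w in eq | nj w
  ... | just a  | _              = fst a eq
  ... | nothing | inj₂ (b , eq′) = snd b eq eq′

  SharedIso : (A → Set ℓ) → (B → Set ℓ) → Set ℓ
  SharedIso F₁ F₂ = ∀ {w a b} → from p₁ w ≡ just a → from p₂ w ≡ just b → F₁ a ↔ F₂ b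

module _ {A B W : Set ℓ} (p₁ : Partial A W) (p₂ : Partial B W)
         {F₁ : A → Set ℓ} {F₂ : B → Set ℓ} (iso : SharedIso p₁ p₂ F₁ F₂) where

  shared : ∀ {a b} → to p₁ a ≡ to p₂ b → F₁ a ↔ F₂ b
  shared {a} {b} e = iso (trans (cong (from p₁) (sym e)) (from-to p₁ a)) (from-to p₂ b)

  convert* : ∀ {as bs} → map (to p₁) as ≡ map (to p₂) bs → All F₁ as → All F₂ bs
  convert* {[]}     {[]}     e []       = []
  convert* {a ∷ as} {b ∷ bs} e (x ∷ xs) =
    Inverse.to (shared (∷-injectiveˡ e)) x ∷ convert* (∷-injectiveʳ e) xs

module _ {A B W : Set ℓ} {p₁ : Partial A W} {p₂ : Partial B W} where

  Glued : (A → Set ℓ) → (B → Set ℓ) → ∀ {w} → Origin p₁ p₂ w → Set ℓ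
  Glued F₁ F₂ (fst a _)   = F₁ a
  Glued F₁ F₂ (snd b _ _) = F₂ b

  module _ {F₁ : A → Set ℓ} {F₂ : B → Set ℓ} where

    glued↔₁ : ∀ {a} (o : Origin p₁ p₂ (to p₁ a)) → Glued F₁ F₂ o ↔ F₁ a
    glued↔₁ {a} (fst a′ eq) with just-injective (trans (sym (from-to p₁ a)) eq)
    ... | refl = ↔-refl
    glued↔₁ {a} (snd b eq _) with trans (sym (from-to p₁ a)) eq
    ... | ()

    glued↔₂ : SharedIso p₁ p₂ F₁ F₂ →
              ∀ {b} (o : Origin p₁ p₂ (to p₂ b)) → Glued F₁ F₂ o ↔ F₂ b
    glued↔₂ iso {b} (fst a eq)    = iso eq (from-to p₂ b)
    glued↔₂ iso {b} (snd b′ _ eq) with just-injective (trans (sym (from-to p₂ b)) eq)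
    ... | refl = ↔-refl

------------------------------------------------------------------------
-- Combined signatures

record Combinable (S₁ S₂ : Signature ℓ) : Set (lsuc ℓ) where
  field
    UnitedSorts  : Set ℓ
    p₁           : Partial (Sorts S₁) UnitedSorts
    p₂           : Partial (Sorts S₂) UnitedSorts
    noJunk-sort  : NoJunk p₁ p₂
    UnitedSymb   : Set ℓ
    q₁           : Partial (Symb S₁) UnitedSymb
    q₂           : Partial (Symb S₂) UnitedSymb
    noJunk-symb  : NoJunk q₁ q₂
    EV-iso       : SharedIso p₁ p₂ (EV S₁) (EV S₂)
    SV-iso       : SharedIso p₁ p₂ (SV S₁) (SV S₂)
    params-agree : ∀ {σ σ₁ σ₂} → from q₁ σ ≡ just σ₁ → from q₂ σ ≡ just σ₂ →
                   map (to p₁) (params S₁ σ₁) ≡ map (to p₂) (params S₂ σ₂)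
    return-agree : ∀ {σ σ₁ σ₂} → from q₁ σ ≡ just σ₁ → from q₂ σ ≡ just σ₂ →
                   to p₁ (return S₁ σ₁) ≡ to p₂ (return S₂ σ₂)

  sortOrigin : ∀ s → Origin p₁ p₂ s
  sortOrigin = origin p₁ p₂ noJunk-sort

  symbOrigin : ∀ σ → Origin q₁ q₂ σ
  symbOrigin = origin q₁ q₂ noJunk-symb

  paramsᶜ : ∀ {σ} → Origin q₁ q₂ σ → List UnitedSorts
  paramsᶜ (fst σ₁ _)   = map (to p₁) (params S₁ σ₁)
  paramsᶜ (snd σ₂ _ _) = map (to p₂) (params S₂ σ₂)

  returnᶜ : ∀ {σ} → Origin q₁ q₂ σ → UnitedSorts
  returnᶜ (fst σ₁ _)   = to p₁ (return S₁ σ₁)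
  returnᶜ (snd σ₂ _ _) = to p₂ (return S₂ σ₂)

open Combinable

module _ {S₁ S₂ : Signature ℓ} (C : Combinable S₁ S₂) where

  combine : Signature ℓ
  Sorts combine = UnitedSorts C
  EV combine s = Glued (EV S₁) (EV S₂) (sortOrigin C s)
  SV combine s = Glued (SV S₁) (SV S₂) (sortOrigin C s)
  EV-infinite combine s with sortOrigin C s
  ... | fst s₁ _   = EV-infinite S₁ s₁
  ... | snd s₂ _ _ = EV-infinite S₂ s₂
  SV-infinite combine s with sortOrigin C s
  ... | fst s₁ _   = SV-infinite S₁ s₁
  ... | snd s₂ _ _ = SV-infinite S₂ s₂
  Symb combine = UnitedSymb C
  params combine σ = paramsᶜ C (symbOrigin C σ)
  return combine σ = returnᶜ C (symbOrigin C σ)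

------------------------------------------------------------------------
-- Lifting patterns along a translation of signatures

record Translation (S T : Signature ℓ) : Set ℓ where
  field
    sort     : Sorts S → Sorts T
    symb     : Symb S → Symb T
    params-≡ : ∀ σ → params T (symb σ) ≡ map sort (params S σ)
    return-≡ : ∀ σ → return T (symb σ) ≡ sort (return S σ)
    ev       : ∀ {s} → EV S s → EV T (sort s)
    sv       : ∀ {s} → SV S s → SV T (sort s)

module _ {S T : Signature ℓ} (tr : Translation S T) where
  open Translation tr

  mutual
    translate : ∀ {ex mu s} → Pattern S ex mu s →
                Pattern T (map sort ex) (map sort mu) (sort s)
    translate (evar x)       = evar (ev x)
    translate (svar X)       = svar (sv X)
    translate (ebound i)     = ebound (∈-map⁺ sort i)
    translate (sbound i)     = sbound (∈-map⁺ sort i)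
    translate (app σ p r φs) =
      app (symb σ) (trans (params-≡ σ) (cong (map sort) p))
                   (trans (return-≡ σ) (cong sort r)) (translates φs)
    translate (neg φ)        = neg (translate φ)
    translate (and φ ψ)      = and (translate φ) (translate ψ)
    translate (exists s′ φ)  = exists (sort s′) (translate φ)
    translate (fix φ)        = fix (translate φ)

    translates : ∀ {ex mu ss} → All (Pattern S ex mu) ss →
                 All (Pattern T (map sort ex) (map sort mu)) (map sort ss)
    translates []       = []
    translates (φ ∷ φs) = translate φ ∷ translates φs

module _ {S₁ S₂ : Signature ℓ} (C : Combinable S₁ S₂) where
  open Translation

  paramsᶜ-≡₁ : ∀ {σ₁} (o : Origin (q₁ C) (q₂ C) (to (q₁ C) σ₁)) →
               paramsᶜ C o ≡ map (to (p₁ C)) (params S₁ σ₁)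
  paramsᶜ-≡₁ {σ₁} (fst σ′ eq) =
    cong (map (to (p₁ C)) ∘ params S₁) (just-injective (trans (sym eq) (from-to (q₁ C) σ₁)))
  paramsᶜ-≡₁ {σ₁} (snd σ′ eq _) with trans (sym (from-to (q₁ C) σ₁)) eq
  ... | ()

  returnᶜ-≡₁ : ∀ {σ₁} (o : Origin (q₁ C) (q₂ C) (to (q₁ C) σ₁)) →
               returnᶜ C o ≡ to (p₁ C) (return S₁ σ₁)
  returnᶜ-≡₁ {σ₁} (fst σ′ eq) =
    cong (to (p₁ C) ∘ return S₁) (just-injective (trans (sym eq) (from-to (q₁ C) σ₁)))
  returnᶜ-≡₁ {σ₁} (snd σ′ eq _) with trans (sym (from-to (q₁ C) σ₁)) eq
  ... | ()

  paramsᶜ-≡₂ : ∀ {σ₂} (o : Origin (q₁ C) (q₂ C) (to (q₂ C) σ₂)) →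
               paramsᶜ C o ≡ map (to (p₂ C)) (params S₂ σ₂)
  paramsᶜ-≡₂ {σ₂} (fst σ′ eq)   = params-agree C eq (from-to (q₂ C) σ₂)
  paramsᶜ-≡₂ {σ₂} (snd σ′ _ eq) =
    cong (map (to (p₂ C)) ∘ params S₂) (just-injective (trans (sym eq) (from-to (q₂ C) σ₂)))

  returnᶜ-≡₂ : ∀ {σ₂} (o : Origin (q₁ C) (q₂ C) (to (q₂ C) σ₂)) →
               returnᶜ C o ≡ to (p₂ C) (return S₂ σ₂)
  returnᶜ-≡₂ {σ₂} (fst σ′ eq)   = return-agree C eq (from-to (q₂ C) σ₂)
  returnᶜ-≡₂ {σ₂} (snd σ′ _ eq) =
    cong (to (p₂ C) ∘ return S₂) (just-injective (trans (sym eq) (from-to (q₂ C) σ₂)))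

  inclusion₁ : Translation S₁ (combine C)
  sort     inclusion₁         = to (p₁ C)
  symb     inclusion₁         = to (q₁ C)
  params-≡ inclusion₁ σ       = paramsᶜ-≡₁ (symbOrigin C (to (q₁ C) σ))
  return-≡ inclusion₁ σ       = returnᶜ-≡₁ (symbOrigin C (to (q₁ C) σ))
  ev       inclusion₁ {s} x   = Inverse.from (glued↔₁ (sortOrigin C (to (p₁ C) s))) x
  sv       inclusion₁ {s} X   = Inverse.from (glued↔₁ (sortOrigin C (to (p₁ C) s))) X

  inclusion₂ : Translation S₂ (combine C)
  sort     inclusion₂         = to (p₂ C)
  symb     inclusion₂         = to (q₂ C)
  params-≡ inclusion₂ σ       = paramsᶜ-≡₂ (symbOrigin C (to (q₂ C) σ))
  return-≡ inclusion₂ σ       = returnᶜ-≡₂ (symbOrigin C (to (q₂ C) σ))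
  ev       inclusion₂ {s} x   = Inverse.from (glued↔₂ (EV-iso C) (sortOrigin C (to (p₂ C) s))) x
  sv       inclusion₂ {s} X   = Inverse.from (glued↔₂ (SV-iso C) (sortOrigin C (to (p₂ C) s))) X

  lift₁ : ∀ {ex mu s} → Pattern S₁ ex mu s →
          Pattern (combine C) (map (to (p₁ C)) ex) (map (to (p₁ C)) mu) (to (p₁ C) s)
  lift₁ = translate inclusion₁

  lift₂ : ∀ {ex mu s} → Pattern S₂ ex mu s →
          Pattern (combine C) (map (to (p₂ C)) ex) (map (to (p₂ C)) mu) (to (p₂ C) s)
  lift₂ = translate inclusion₂

  combineT : Theory S₁ → Theory S₂ → Theory (combine C)
  combineT Γ₁ Γ₂ =
    (λ ψ → Σ (∃ (Pattern S₁ [] [])) λ (s , φ) → (s , φ) ∈ᴾ Γ₁ × ψ ≡ (to (p₁ C) s , lift₁ φ)) ∪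
    (λ ψ → Σ (∃ (Pattern S₂ [] [])) λ (s , φ) → (s , φ) ∈ᴾ Γ₂ × ψ ≡ (to (p₂ C) s , lift₂ φ))

------------------------------------------------------------------------
-- Glued models

record Gluable {S₁ S₂ : Signature ℓ} (M₁ : Model S₁) (M₂ : Model S₂) : Set (lsuc ℓ) where
  field
    combinable  : Combinable S₁ S₂
    carrier-iso : SharedIso (p₁ combinable) (p₂ combinable) (Carrier M₁) (Carrier M₂)
    app-agree   : ∀ {σ σ₁ σ₂}
                  (e₁ : from (q₁ combinable) σ ≡ just σ₁)
                  (e₂ : from (q₂ combinable) σ ≡ just σ₂)
                  (as : All (Carrier M₁) (params S₁ σ₁)) →
                  appᴹ M₁ σ₁ as ≐
                  (Inverse.to (shared (p₁ combinable) (p₂ combinable) carrier-iso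
                                      (return-agree combinable e₁ e₂)) ⊢
                   appᴹ M₂ σ₂ (convert* (p₁ combinable) (p₂ combinable) carrier-iso
                                      (params-agree combinable e₁ e₂) as))

open Gluable

module _ {S₁ S₂ : Signature ℓ} {M₁ : Model S₁} {M₂ : Model S₂} (G : Gluable M₁ M₂) where

  private
    C = combinable G

  GluedCarrier : UnitedSorts C → Set ℓ
  GluedCarrier s = Glued (Carrier M₁) (Carrier M₂) (sortOrigin C s)

  carrier↔₁ : ∀ {s} → GluedCarrier (to (p₁ C) s) ↔ Carrier M₁ s
  carrier↔₁ {s} = glued↔₁ (sortOrigin C (to (p₁ C) s))

  carrier↔₂ : ∀ {s} → GluedCarrier (to (p₂ C) s) ↔ Carrier M₂ s
  carrier↔₂ {s} = glued↔₂ (carrier-iso G) (sortOrigin C (to (p₂ C) s))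

  gluedApp : ∀ {σ} (o : Origin (q₁ C) (q₂ C) σ) →
             All GluedCarrier (paramsᶜ C o) → Pred (GluedCarrier (returnᶜ C o)) ℓ
  gluedApp (fst σ₁ _)   as =
    Inverse.to carrier↔₁ ⊢ appᴹ M₁ σ₁ (All.map (Inverse.to carrier↔₁) (map⁻ as))
  gluedApp (snd σ₂ _ _) as =
    Inverse.to carrier↔₂ ⊢ appᴹ M₂ σ₂ (All.map (Inverse.to carrier↔₂) (map⁻ as))

  glueM : Model (combine C)
  Carrier glueM = GluedCarrier
  nonempty glueM s with sortOrigin C s
  ... | fst s₁ _   = nonempty M₁ s₁
  ... | snd s₂ _ _ = nonempty M₂ s₂
  appᴹ glueM σ = gluedApp (symbOrigin C σ)

{-# OPTIONS --safe #-}

-- Each Mᵢ is, up to isomorphism of carriers, the reduct of the glued model along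
-- the inclusion of its signature, and satisfaction is preserved by reducts. The
-- fresh names chosen by the given semantics differ between a pattern and its
-- translation, so both are compared with a structural semantics that interprets
-- de Bruijn indices by environments and chooses no names. A valuation of the
-- glued model then only has to be restricted along the inclusion, and
-- surjectivity on variables plays no role.
module Submission where

open import Defs
open import Axiom.ExcludedMiddle using (ExcludedMiddle)
open import Axiom.UniquenessOfIdentityProofs using (UIP; module Decidable⇒UIP)
open import Data.List using (List; []; _∷_; map)
open import Data.List.Membership.Propositional using (_∈_)
open import Data.List.Membership.Propositional.Properties using (∈-map⁺; ∈-++⁺ˡ; ∈-++⁺ʳ)
open import Data.List.Properties using (∷-injectiveˡ; ∷-injectiveʳ)
open import Data.List.Relation.Unary.All as All using (All; []; _∷_)
open import Data.List.Relation.Unary.All.Properties using (map⁻)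
open import Data.List.Relation.Unary.Any using (here; there)
open import Data.Maybe using (just)
open import Data.Maybe.Properties using (just-injective)
open import Data.Nat using (_<_)
open import Data.Nat.Induction using (Acc; acc; <-wellFounded)
open import Data.Product using (Σ; ∃; _×_; _,_; proj₁; proj₂)
open import Data.Sum using (inj₁; inj₂; [_,_]′)
open import Data.Unit.Polymorphic using (tt)
open import Function using (_∘_; id; _↔_; Inverse)
open import Function.Properties.Inverse using (↔-refl)
open import Level using (Level; suc; lift; lower)
open import Relation.Binary.PropositionalEquality
  using (_≡_; refl; sym; trans; cong; cong₂; subst; ≡-≟-identity)
open import Relation.Binary.PropositionalEquality.Properties using (trans-reflʳ)
open import Relation.Nullary using (yes; no; contradiction)
open import Relation.Nullary.Decidable using (toWitness; fromWitness)
open import Relation.Unary using (Pred; _⊆_; _≐_; _⊢_; ∁; _∩_; ｛_｝; ⋃; ⋂)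
open import Relation.Unary.Polymorphic using (∅)
open import Relation.Unary.Properties using (≐-refl; ≐-trans)

open Signature
open Model
open Valuation
open Partial
open Combinable
open Gluable

private
  variable
    ℓ : Level

-- Transport along equalities of sorts and of lists of sorts.

cast : ∀ {A : Set ℓ} {C : A → Set ℓ} {ss ss′ s s′} → ss ≡ ss′ → s ≡ s′ →
       (All C ss → Pred (C s) ℓ) → All C ss′ → Pred (C s′) ℓ
cast refl refl f = f

subst-∷ : ∀ {A : Set ℓ} {C : A → Set ℓ} {s s′ ss ss′} (e : s ∷ ss ≡ s′ ∷ ss′)
          (x : C s) (xs : All C ss) →
          subst (All C) e (x ∷ xs) ≡ subst C (∷-injectiveˡ e) x ∷ subst (All C) (∷-injectiveʳ e) xs
subst-∷ refl x xs = refl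

-- Trades the transport of an operation for transports of its arguments and of the tested element,
-- the form in which agreement of shared symbols becomes available.
cast-≐ : ∀ {A : Set ℓ} {C : A → Set ℓ} {ss ss′ s s′} (p : ss ≡ ss′) (r : s ≡ s′)
         {f : All C ss → Pred (C s) ℓ} {g : All C ss′ → Pred (C s′) ℓ} →
         (∀ xs {x} → (f xs x → g (subst (All C) p xs) (subst C r x)) ×
                     (g (subst (All C) p xs) (subst C r x) → f xs x)) →
         ∀ xs → cast {C = C} p r f xs ≐ g xs
cast-≐ refl refl h xs = proj₁ (h xs) , proj₂ (h xs)

module _ (em : ExcludedMiddle (suc ℓ)) where

  open Semantics em

  -- Hedberg's theorem, with equality decided by excluded middle. A `SharedIso` depends on the
  -- proofs that locate a sort on each side, and two such proofs have to be identified below.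
  uip : {A : Set ℓ} → UIP A
  uip = Decidable⇒UIP.≡-irrelevant _≟_

  -- The same expression as in the `fix` clause of `interp`. For a non-monotone `F` it is only the
  -- intersection of the pre-fixed points.
  lfp : {A : Set ℓ} → (Pred A ℓ → Pred A ℓ) → Pred A ℓ
  lfp F = resize (⋂ (Σ (Pred _ ℓ) λ A → F A ⊆ A) proj₁)

  -- Preimages along `c` and along its inverse carry pre-fixed points to pre-fixed points. The
  -- hypothesis ranges over all related pairs `P`, `Q`, since predicates that agree pointwise need
  -- not be equal.
  lfp-≐ : {A B : Set ℓ} (c : B ↔ A) {F : Pred A ℓ → Pred A ℓ} {G : Pred B ℓ → Pred B ℓ} →
          (∀ {P Q} → Q ≐ Inverse.to c ⊢ P → G Q ≐ Inverse.to c ⊢ F P) →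
          lfp G ≐ Inverse.to c ⊢ lfp F
  lfp-≐ c {F} {G} G≐F = forward , backward
    where
    open Inverse c renaming (to to f; from to g)
    forward : lfp G ⊆ f ⊢ lfp F
    forward y∈ = lift (fromWitness λ (P , FP⊆P) →
      toWitness (lower y∈) (f ⊢ P , λ z∈ → FP⊆P (proj₁ (G≐F ≐-refl) z∈)))
    backward : f ⊢ lfp F ⊆ lfp G
    backward {y} fy∈ = lift (fromWitness λ (Q , GQ⊆Q) →
      -- An arbitrary `Q` is a preimage along `f` only up to `≐`, so it is paired with `g ⊢ Q` in
      -- the hypothesis.
      let Q≐ : Q ≐ f ⊢ (g ⊢ Q)
          Q≐ = (λ {z} → subst Q (sym (strictlyInverseʳ z))) ,
               (λ {z} → subst Q (strictlyInverseʳ z))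
      in proj₂ Q≐ (toWitness (lower fy∈) (g ⊢ Q , λ {x} x∈ →
           GQ⊆Q (proj₂ (G≐F Q≐) (subst (F (g ⊢ Q)) (sym (strictlyInverseˡ x)) x∈)))))

  -- Structural semantics and instantiation of indices.

  Env : {S : Signature ℓ} → Model S → List (Sorts S) → Set (suc ℓ)
  Env M Γ = ∀ {s} → s ∈ Γ → Pred (Carrier M s) ℓ

  module _ {S : Signature ℓ} {M : Model S} where

    infixr 5 _◂_

    _◂_ : ∀ {Γ s} → Pred (Carrier M s) ℓ → Env M Γ → Env M (s ∷ Γ)
    (P ◂ E) (here refl) = P
    (P ◂ E) (there i)   = E i

    mutual
      -- Element indices denote subsets as well, singletons once bound by `exists`; one notion of
      -- environment then serves both kinds of index, and a dangling index can be given the value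
      -- `∅`.
      sem : ∀ {ex mu s} → Pattern S ex mu s → Valuation M → Env M ex → Env M mu →
            Pred (Carrier M s) ℓ
      sem (evar x)       ρ E Z = ｛ evalᵉ ρ x ｝
      sem (svar X)       ρ E Z = evalˢ ρ X
      sem (ebound i)     ρ E Z = E i
      sem (sbound i)     ρ E Z = Z i
      -- The equations are not matched: those of a translated pattern relate lists and sorts that do
      -- not unify, so the operation is transported instead.
      sem (app σ p r φs) ρ E Z =
        ⋃ (∃ λ as → as ∈* sems φs ρ E Z) λ (as , _) → cast p r (appᴹ M σ) as
      sem (neg φ)        ρ E Z = ∁ (sem φ ρ E Z)
      sem (and φ ψ)      ρ E Z = sem φ ρ E Z ∩ sem ψ ρ E Z
      sem (exists s′ φ)  ρ E Z = ⋃ (Carrier M s′) λ m → sem φ ρ (｛ m ｝ ◂ E) Z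
      sem (fix φ)        ρ E Z = lfp λ A → sem φ ρ E (A ◂ Z)

      sems : ∀ {ex mu ss} → All (Pattern S ex mu) ss → Valuation M → Env M ex → Env M mu →
             All (λ s → Pred (Carrier M s) ℓ) ss
      sems []       ρ E Z = []
      sems (φ ∷ φs) ρ E Z = sem φ ρ E Z ∷ sems φs ρ E Z

    evar-free : ∀ {ex mu s} (x : EV S s) → x ∈ freeᵉ s (evar {S = S} {ex} {mu} x)
    -- `freeᵉ` branches on `s ≟ s`, which is stuck on `em` until rewritten to `yes refl`.
    evar-free {s = s} x rewrite ≡-≟-identity _≟_ {s} refl = here refl

    svar-free : ∀ {ex mu s} (X : SV S s) → X ∈ freeˢ s (svar {S = S} {ex} {mu} X)
    svar-free {s = s} X rewrite ≡-≟-identity _≟_ {s} refl = here refl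

    mutual
      -- The substitution lemma. The valuations need agree only on names free in `φ`, so `ρ′` may be
      -- an update of `ρ` at a fresh name, with the value of that name stored in the environment on
      -- the other side.
      sem-inst : ∀ {ex ex′ mu mu′ s} (ε : Inst (EV S) ex ex′) (τ : Inst (SV S) mu mu′)
                 (φ : Pattern S ex mu s) {ρ ρ′ : Valuation M}
                 {E : Env M ex} {E′ : Env M ex′} {Z : Env M mu} {Z′ : Env M mu′} →
                 (∀ {t x} → x ∈ freeᵉ t φ → evalᵉ ρ′ x ≡ evalᵉ ρ x) →
                 (∀ {t X} → X ∈ freeˢ t φ → evalˢ ρ′ X ≐ evalˢ ρ X) →
                 (∀ {t} (i : t ∈ ex) → [ E′ , ｛_｝ ∘ evalᵉ ρ′ ]′ (ε i) ≐ E i) →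
                 (∀ {t} (i : t ∈ mu) → [ Z′ , evalˢ ρ′ ]′ (τ i) ≐ Z i) →
                 sem (inst ε τ φ) ρ′ E′ Z′ ≐ sem φ ρ E Z
      sem-inst {ex} {mu = mu} ε τ (evar x) fe fs hE hZ rewrite fe (evar-free {ex} {mu} x) = ≐-refl
      sem-inst {ex} {mu = mu} ε τ (svar X) fe fs hE hZ = fs (svar-free {ex} {mu} X)
      sem-inst ε τ (ebound i) fe fs hE hZ with ε i | hE i
      ... | inj₁ j | h = h
      ... | inj₂ x | h = h
      sem-inst ε τ (sbound i) fe fs hE hZ with τ i | hZ i
      ... | inj₁ j | h = h
      ... | inj₂ x | h = h
      sem-inst ε τ (app σ p r φs) fe fs hE hZ =
        let f , g = sems-inst ε τ φs fe fs hE hZ in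
        (λ { ((as , m) , a) → (as , f m) , a }) , (λ { ((as , m) , a) → (as , g m) , a })
      sem-inst ε τ (neg φ) fe fs hE hZ =
        let f , g = sem-inst ε τ φ fe fs hE hZ in (λ n → n ∘ g) , (λ n → n ∘ f)
      sem-inst ε τ (and φ ψ) fe fs hE hZ =
        let f , g = sem-inst ε τ φ (fe ∘ ∈-++⁺ˡ) (fs ∘ ∈-++⁺ˡ) hE hZ
            h , k = sem-inst ε τ ψ (fe ∘ ∈-++⁺ʳ _) (fs ∘ ∈-++⁺ʳ _) hE hZ
        in (λ (a , b) → f a , h b) , (λ (a , b) → g a , k b)
      sem-inst ε τ (exists s′ φ) {ρ′ = ρ′} {E = E} {E′} fe fs hE hZ =
        (λ (m , a) → m , proj₁ (ih m) a) , (λ (m , a) → m , proj₂ (ih m) a)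
        where
        ih = λ m → sem-inst (liftInst ε) τ φ fe fs (hE′ m) hZ
          where
          hE′ : ∀ m {t} (i : t ∈ _) →
                [ ｛ m ｝ ◂ E′ , ｛_｝ ∘ evalᵉ ρ′ ]′ (liftInst ε i) ≐ (｛ m ｝ ◂ E) i
          hE′ m (here refl) = ≐-refl
          hE′ m (there i) with ε i | hE i
          ... | inj₁ j | h = h
          ... | inj₂ x | h = h
      sem-inst ε τ (fix φ) {ρ′ = ρ′} {Z = Z} {Z′} fe fs hE hZ =
        -- Along the identity, `lfp-≐` is congruence of `lfp`; its related pairs are why set
        -- environments are compared up to `≐`.
        lfp-≐ ↔-refl λ Q≐P → sem-inst ε (liftInst τ) φ fe fs hE (hZ′ Q≐P)
        where
        hZ′ : ∀ {P Q : Pred _ ℓ} → Q ≐ P → ∀ {t} (i : t ∈ _) →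
              [ Q ◂ Z′ , evalˢ ρ′ ]′ (liftInst τ i) ≐ (P ◂ Z) i
        hZ′ Q≐P (here refl) = Q≐P
        hZ′ Q≐P (there i) with τ i | hZ i
        ... | inj₁ j | h = h
        ... | inj₂ x | h = h

      -- Stated for membership of tuples, because the two lists of predicates agree only pointwise.
      sems-inst : ∀ {ex ex′ mu mu′ ss} (ε : Inst (EV S) ex ex′) (τ : Inst (SV S) mu mu′)
                  (φs : All (Pattern S ex mu) ss) {ρ ρ′ : Valuation M}
                  {E : Env M ex} {E′ : Env M ex′} {Z : Env M mu} {Z′ : Env M mu′} →
                  (∀ {t x} → x ∈ freesᵉ t φs → evalᵉ ρ′ x ≡ evalᵉ ρ x) →
                  (∀ {t X} → X ∈ freesˢ t φs → evalˢ ρ′ X ≐ evalˢ ρ X) →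
                  (∀ {t} (i : t ∈ ex) → [ E′ , ｛_｝ ∘ evalᵉ ρ′ ]′ (ε i) ≐ E i) →
                  (∀ {t} (i : t ∈ mu) → [ Z′ , evalˢ ρ′ ]′ (τ i) ≐ Z i) →
                  (_∈* sems (insts ε τ φs) ρ′ E′ Z′) ≐ (_∈* sems φs ρ E Z)
      sems-inst ε τ [] fe fs hE hZ = (λ { {[]} _ → tt }) , (λ { {[]} _ → tt })
      sems-inst ε τ (φ ∷ φs) fe fs hE hZ =
        let f , g = sem-inst ε τ φ (fe ∘ ∈-++⁺ˡ) (fs ∘ ∈-++⁺ˡ) hE hZ
            h , k = sems-inst ε τ φs (fe ∘ ∈-++⁺ʳ _) (fs ∘ ∈-++⁺ʳ _) hE hZ
        in (λ { {_ ∷ _} (a , b) → f a , h b }) , (λ { {_ ∷ _} (a , b) → g a , k b })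

    -- Fresh-name updates and agreement with the given semantics.

    module _ (ρ : Valuation M) {s : Sorts S} where

      updateᵉ-same : (x : EV S s) (m : Carrier M s) → evalᵉ (ρ [ x ↦ m ]ᵉ) x ≡ m
      updateᵉ-same x m rewrite ≡-≟-identity (_≟_ {A = ∃ (EV S)}) {s , x} refl = refl

      updateˢ-same : (X : SV S s) (A : Pred (Carrier M s) ℓ) → evalˢ (ρ [ X ↦ A ]ˢ) X ≡ A
      updateˢ-same X A rewrite ≡-≟-identity (_≟_ {A = ∃ (SV S)}) {s , X} refl = refl

      updateᵉ-fresh : ∀ {ex mu t u} (φ : Pattern S ex mu t) (m : Carrier M s) {y : EV S u} →
                      y ∈ freeᵉ u φ → evalᵉ (ρ [ freshᵉ s φ ↦ m ]ᵉ) y ≡ evalᵉ ρ y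
      updateᵉ-fresh {u = u} φ m {y} y∈ with _≟_ {A = ∃ (EV S)} (s , freshᵉ s φ) (u , y)
      ... | yes refl = contradiction y∈ (proj₂ (EV-infinite S s (freeᵉ s φ)))
      ... | no _     = refl

      updateˢ-fresh : ∀ {ex mu t u} (φ : Pattern S ex mu t) (A : Pred (Carrier M s) ℓ)
                      {Y : SV S u} →
                      Y ∈ freeˢ u φ → evalˢ (ρ [ freshˢ s φ ↦ A ]ˢ) Y ≐ evalˢ ρ Y
      updateˢ-fresh {u = u} φ A {Y} Y∈ with _≟_ {A = ∃ (SV S)} (s , freshˢ s φ) (u , Y)
      ... | yes refl = contradiction Y∈ (proj₂ (SV-infinite S s (freeˢ s φ)))
      ... | no _     = ≐-refl

    ∅ᴱ : ∀ {Γ} → Env M Γ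
    ∅ᴱ _ = ∅

    -- Index zero becomes the fresh name, whose updated value is `m`; freshness keeps the names of
    -- `φ` unchanged.
    sem-openᵉ : ∀ {ex mu s s′} (φ : Pattern S (s′ ∷ ex) mu s) (ρ : Valuation M) m →
                sem (openᵉ (freshᵉ s′ φ) φ) (ρ [ freshᵉ s′ φ ↦ m ]ᵉ) ∅ᴱ ∅ᴱ ≐
                sem φ ρ (｛ m ｝ ◂ ∅ᴱ) ∅ᴱ
    sem-openᵉ {ex} {s′ = s′} φ ρ m =
      sem-inst _ _ φ (updateᵉ-fresh ρ φ m) (λ _ → ≐-refl) hE (λ _ → ≐-refl)
      where
      x = freshᵉ s′ φ
      hE : ∀ {t} (i : t ∈ s′ ∷ ex) →
           [ ∅ᴱ , ｛_｝ ∘ evalᵉ (ρ [ x ↦ m ]ᵉ) ]′ (outermost x i) ≐ (｛ m ｝ ◂ ∅ᴱ) i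
      hE (here refl) rewrite updateᵉ-same ρ x m = ≐-refl
      hE (there i)   = ≐-refl

    -- Separate `A` and `B` give it the shape of the premise of `lfp-≐`.
    sem-openˢ : ∀ {ex mu s s′} (φ : Pattern S ex (s′ ∷ mu) s) (ρ : Valuation M) {A B} → A ≐ B →
                sem (openˢ (freshˢ s′ φ) φ) (ρ [ freshˢ s′ φ ↦ A ]ˢ) ∅ᴱ ∅ᴱ ≐
                sem φ ρ ∅ᴱ (B ◂ ∅ᴱ)
    sem-openˢ {mu = mu} {s′ = s′} φ ρ {A} {B} A≐B =
      sem-inst _ _ φ (λ _ → refl) (updateˢ-fresh ρ φ A) (λ _ → ≐-refl) hZ
      where
      X = freshˢ s′ φ
      hZ : ∀ {t} (i : t ∈ s′ ∷ mu) →
           [ ∅ᴱ , evalˢ (ρ [ X ↦ A ]ˢ) ]′ (outermost X i) ≐ (B ◂ ∅ᴱ) i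
      hZ (here refl) rewrite updateˢ-same ρ X A = A≐B
      hZ (there i)   = ≐-refl

    mutual
      -- An opened body is no subterm, so the induction descends on the accessibility proof, which
      -- is left arbitrary to fit the recursive calls of `interp`. Opening is then undone by
      -- `sem-openᵉ` and `sem-openˢ`.
      interp≐sem : ∀ {ex mu s} (φ : Pattern S ex mu s) (a : Acc _<_ (size φ)) (ρ : Valuation M) →
                   interp M φ a ρ ≐ sem φ ρ ∅ᴱ ∅ᴱ
      interp≐sem (evar x)   _ ρ = ≐-refl
      interp≐sem (svar X)   _ ρ = ≐-refl
      interp≐sem (ebound i) _ ρ = ≐-refl
      interp≐sem (sbound i) _ ρ = ≐-refl
      interp≐sem (app σ refl refl φs) (acc rs) ρ =
        let f , g = interps≐sems φs _ ρ in
        (λ { ((as , m) , a) → (as , f m) , a }) , (λ { ((as , m) , a) → (as , g m) , a })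
      interp≐sem (neg φ) (acc rs) ρ =
        let f , g = interp≐sem φ _ ρ in (λ n → n ∘ g) , (λ n → n ∘ f)
      interp≐sem (and φ ψ) (acc rs) ρ =
        let f , g = interp≐sem φ _ ρ
            h , k = interp≐sem ψ _ ρ
        in (λ (a , b) → f a , h b) , (λ (a , b) → g a , k b)
      interp≐sem (exists s′ φ) (acc rs) ρ =
        (λ (m , a) → m , proj₁ (ih m) a) , (λ (m , a) → m , proj₂ (ih m) a)
        where ih = λ m → ≐-trans (interp≐sem (openᵉ _ φ) (rs _) _) (sem-openᵉ φ ρ m)
      interp≐sem (fix φ) (acc rs) ρ = lfp-≐ ↔-refl λ Q≐P →
        ≐-trans (interp≐sem (openˢ _ φ) (rs _) _) (sem-openˢ φ ρ Q≐P)

      interps≐sems : ∀ {ex mu ss} (φs : All (Pattern S ex mu) ss) (a : Acc _<_ (sizes φs))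
                     (ρ : Valuation M) →
                     (_∈* interps M φs a ρ) ≐ (_∈* sems φs ρ ∅ᴱ ∅ᴱ)
      interps≐sems [] _ ρ = (λ { {[]} _ → tt }) , (λ { {[]} _ → tt })
      interps≐sems (φ ∷ φs) (acc rs) ρ =
        let f , g = interp≐sem φ _ ρ
            h , k = interps≐sems φs _ ρ
        in (λ { {_ ∷ _} (a , b) → f a , h b }) , (λ { {_ ∷ _} (a , b) → g a , k b })

  -- Satisfaction along reducts.

  module _ {S T : Signature ℓ} (tr : Translation S T) {M : Model S} {N : Model T} where
    open Translation tr

    -- M is, up to isomorphism, the reduct of N along tr.
    record Reduct : Set (suc ℓ) where
      field
        carrier : ∀ {s} → Carrier N (sort s) ↔ Carrier M s

      ⇓ : ∀ {s} → Carrier N (sort s) → Carrier M s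
      ⇓ = Inverse.to carrier

      ⇓* : ∀ {ss} → All (Carrier N) (map sort ss) → All (Carrier M) ss
      ⇓* = All.map ⇓ ∘ map⁻

      field
        app-≐ : ∀ σ as → cast (params-≡ σ) (return-≡ σ) (appᴹ N (symb σ)) as ≐
                         ⇓ ⊢ appᴹ M σ (⇓* as)

    module _ (R : Reduct) where
      open Reduct R

      ⇑ : ∀ {s} → Carrier M s → Carrier N (sort s)
      ⇑ = Inverse.from carrier

      ⇓⇑ : ∀ {s} (a : Carrier M s) → ⇓ (⇑ a) ≡ a
      ⇓⇑ = Inverse.strictlyInverseˡ carrier

      ⇑⇓ : ∀ {s} (b : Carrier N (sort s)) → ⇑ (⇓ b) ≡ b
      ⇑⇓ = Inverse.strictlyInverseʳ carrier

      ⇑* : ∀ {ss} → All (Carrier M) ss → All (Carrier N) (map sort ss)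
      ⇑* []       = []
      ⇑* (a ∷ as) = ⇑ a ∷ ⇑* as

      ⇓*⇑* : ∀ {ss} (as : All (Carrier M) ss) → ⇓* (⇑* as) ≡ as
      ⇓*⇑* []       = refl
      ⇓*⇑* (a ∷ as) = cong₂ _∷_ (⇓⇑ a) (⇓*⇑* as)

      -- Keeping `b` and `a` apart lets `exists` use it both ways: with `a` as `⇓ b`, and with `b`
      -- as `⇑ a`.
      ｛｝-≐ : ∀ {s} {b : Carrier N (sort s)} {a} → ⇓ b ≡ a → ｛ b ｝ ≐ ⇓ ⊢ ｛ a ｝
      ｛｝-≐ {b = b} refl =
        cong ⇓ , λ {b′} e → trans (sym (⇑⇓ b)) (trans (cong ⇑ e) (⇑⇓ b′))

      -- Since `⇑` and `⇓` are inverse, the preimage along `⇑` is the image under `⇓`.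
      restrict : Valuation N → Valuation M
      evalᵉ (restrict ρ) x = ⇓ (evalᵉ ρ (ev x))
      evalˢ (restrict ρ) X = ⇑ ⊢ evalˢ ρ (sv X)

      infix 4 _≐ᴱ_

      _≐ᴱ_ : ∀ {Γ} → Env N (map sort Γ) → Env M Γ → Set ℓ
      _≐ᴱ_ {Γ} E′ E = ∀ {s} (i : s ∈ Γ) → E′ (∈-map⁺ sort i) ≐ ⇓ ⊢ E i

      ◂-≐ᴱ : ∀ {Γ s} {Q : Pred (Carrier N (sort s)) ℓ} {P : Pred (Carrier M s) ℓ}
             {E′ : Env N (map sort Γ)} {E : Env M Γ} →
             Q ≐ ⇓ ⊢ P → E′ ≐ᴱ E →
             _≐ᴱ_ {s ∷ Γ} (_◂_ {M = N} Q E′) (_◂_ {M = M} P E)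
      ◂-≐ᴱ Q≐P h (here refl) = Q≐P
      ◂-≐ᴱ Q≐P h (there i)   = h i

      mutual
        -- Induction on `φ`. Witnesses of `exists` correspond along `carrier`, and so do the
        -- pre-fixed points behind `fix`.
        sem-translate : ∀ {ex mu s} (φ : Pattern S ex mu s) (ρ : Valuation N)
                        {E′ : Env N (map sort ex)} {E : Env M ex}
                        {Z′ : Env N (map sort mu)} {Z : Env M mu} →
                        E′ ≐ᴱ E → Z′ ≐ᴱ Z →
                        sem (translate tr φ) ρ E′ Z′ ≐ ⇓ ⊢ sem φ (restrict ρ) E Z
        sem-translate (evar x) ρ hE hZ = ｛｝-≐ refl
        sem-translate (svar X) ρ hE hZ =
          (λ {b} → subst (evalˢ ρ (sv X)) (sym (⇑⇓ b))) ,
          (λ {b} → subst (evalˢ ρ (sv X)) (⇑⇓ b))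
        sem-translate (ebound i) ρ hE hZ = hE i
        sem-translate (sbound i) ρ hE hZ = hZ i
        sem-translate (app σ refl refl φs) ρ {E = E} {Z = Z} hE hZ
          -- `translate` composes `params-≡` and `return-≡` with `refl`; removing it exposes the
          -- `cast` of `app-≐`.
          rewrite trans-reflʳ (params-≡ σ) | trans-reflʳ (return-≡ σ) =
          let f , g = sems-translate φs ρ hE hZ in
          (λ { ((bs , m) , b) → (⇓* bs , f m) , proj₁ (app-≐ σ bs) b }) ,
          -- The arguments are moved up by `⇑*`; `app-≐` and the induction hypothesis then speak of
          -- `⇓* (⇑* as)`, which is turned back into `as`.
          (λ { {b} ((as , m) , a) →
            (⇑* as , g (subst (_∈* sems φs (restrict ρ) E Z) (sym (⇓*⇑* as)) m)) ,
            proj₂ (app-≐ σ (⇑* as))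
              (subst (λ as′ → appᴹ M σ as′ (⇓ b)) (sym (⇓*⇑* as)) a) })
        sem-translate (neg φ) ρ hE hZ =
          let f , g = sem-translate φ ρ hE hZ in (λ n → n ∘ g) , (λ n → n ∘ f)
        sem-translate (and φ ψ) ρ hE hZ =
          let f , g = sem-translate φ ρ hE hZ
              h , k = sem-translate ψ ρ hE hZ
          in (λ (a , b) → f a , h b) , (λ (a , b) → g a , k b)
        sem-translate (exists s′ φ) ρ hE hZ =
          (λ (m , a) → ⇓ m , proj₁ (ih refl) a) , (λ (m , a) → ⇑ m , proj₂ (ih (⇓⇑ m)) a)
          where ih = λ {m} {m′} (e : ⇓ m ≡ m′) → sem-translate φ ρ (◂-≐ᴱ (｛｝-≐ e) hE) hZ
        sem-translate (fix φ) ρ hE hZ =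
          lfp-≐ carrier λ Q≐P → sem-translate φ ρ hE (◂-≐ᴱ Q≐P hZ)

        sems-translate : ∀ {ex mu ss} (φs : All (Pattern S ex mu) ss) (ρ : Valuation N)
                         {E′ : Env N (map sort ex)} {E : Env M ex}
                         {Z′ : Env N (map sort mu)} {Z : Env M mu} →
                         E′ ≐ᴱ E → Z′ ≐ᴱ Z →
                         (_∈* sems (translates tr φs) ρ E′ Z′) ≐
                         ⇓* ⊢ (_∈* sems φs (restrict ρ) E Z)
        sems-translate [] ρ hE hZ = (λ { {[]} _ → tt }) , (λ { {[]} _ → tt })
        sems-translate (φ ∷ φs) ρ hE hZ =
          let f , g = sem-translate φ ρ hE hZ
              h , k = sems-translate φs ρ hE hZ
          in (λ { {_ ∷ _} (a , b) → f a , h b }) , (λ { {_ ∷ _} (a , b) → g a , k b })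

      ⟦translate⟧ : ∀ {s} (φ : Pattern S [] [] s) (ρ : Valuation N) →
                    ⟦_⟧ N (translate tr φ) ρ ≐ ⇓ ⊢ ⟦_⟧ M φ (restrict ρ)
      ⟦translate⟧ φ ρ =
        let f , g = interp≐sem (translate tr φ) (<-wellFounded _) ρ
            -- In a closed pattern there are no indices whose values must correspond.
            h , k = sem-translate φ ρ (λ ()) (λ ())
            u , v = interp≐sem φ (<-wellFounded _) (restrict ρ)
        in v ∘ h ∘ f , g ∘ k ∘ u

  -- Coherence of the two projections out of a glued family.

  module _ {A B W : Set ℓ} (p₁ : Partial A W) (p₂ : Partial B W) {F₁ : A → Set ℓ} {F₂ : B → Set ℓ}
           (iso : SharedIso p₁ p₂ F₁ F₂) (orig : ∀ w → Origin p₁ p₂ w) where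

    private
      G : W → Set ℓ
      G w = Glued F₁ F₂ (orig w)

    -- The forward map of `glued↔₁` with `to p₁ a` generalized to any `w` located at `a`. An
    -- equation `to p₁ a ≡ to p₂ b` cannot be matched, whereas one between variables `w` and `w′`
    -- can.
    unglue₁ : ∀ {w a} → from p₁ w ≡ just a → (o : Origin p₁ p₂ w) → Glued F₁ F₂ o → F₁ a
    unglue₁ e (fst a eq) y with just-injective (trans (sym e) eq)
    ... | refl = y
    unglue₁ e (snd b eq _) y with trans (sym e) eq
    ... | ()

    glued↔₁-unglue₁ : ∀ {a} (o : Origin p₁ p₂ (to p₁ a)) (y : Glued F₁ F₂ o) →
                      Inverse.to (glued↔₁ o) y ≡ unglue₁ (from-to p₁ a) o y
    glued↔₁-unglue₁ {a} (fst a′ eq) y with just-injective (trans (sym (from-to p₁ a)) eq)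
    ... | refl = refl
    glued↔₁-unglue₁ {a} (snd b eq _) y with trans (sym (from-to p₁ a)) eq
    ... | ()

    -- At a shared point the origin must be `fst`, and both sides apply `iso`, to possibly different
    -- location proofs; `uip` identifies these.
    glued↔₂-unglue₁ : ∀ {a b} (e : from p₁ (to p₂ b) ≡ just a) (o : Origin p₁ p₂ (to p₂ b))
                      (y : Glued F₁ F₂ o) →
                      Inverse.to (iso e (from-to p₂ b)) (unglue₁ e o y) ≡
                      Inverse.to (glued↔₂ iso o) y
    glued↔₂-unglue₁ {b = b} e (fst a eq) y with just-injective (trans (sym e) eq)
    ... | refl = cong (λ e′ → Inverse.to (iso e′ (from-to p₂ b)) y) (uip e eq)
    glued↔₂-unglue₁ e (snd b eq _) y with trans (sym e) eq
    ... | ()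

    -- The location proof on the right is the one built into `shared`.
    unglue₁-subst : ∀ {w w′ a} (e : w ≡ w′) (f : from p₁ w ≡ just a) (y : G w) →
                    unglue₁ f (orig w) y ≡
                    unglue₁ (trans (cong (from p₁) (sym e)) f) (orig w′) (subst G e y)
    unglue₁-subst refl f y = refl

    -- Coherence at a shared sort: projecting to the first side and crossing over equals
    -- transporting and projecting to the second.
    shared-glued : ∀ {a b} (e : to p₁ a ≡ to p₂ b) (y : G (to p₁ a)) →
                   Inverse.to (shared p₁ p₂ iso e) (Inverse.to (glued↔₁ (orig (to p₁ a))) y) ≡
                   Inverse.to (glued↔₂ iso (orig (to p₂ b))) (subst G e y)
    shared-glued {a} {b} e y =
      trans (cong (Inverse.to (shared p₁ p₂ iso e))
                  (trans (glued↔₁-unglue₁ (orig _) y) (unglue₁-subst e (from-to p₁ a) y)))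
            (glued↔₂-unglue₁ _ (orig _) (subst G e y))

    convert*-glued : ∀ {as bs} (e : map (to p₁) as ≡ map (to p₂) bs) (ys : All G (map (to p₁) as)) →
                     convert* p₁ p₂ iso e
                       (All.map (λ {a} → Inverse.to (glued↔₁ (orig (to p₁ a)))) (map⁻ ys)) ≡
                     All.map (λ {b} → Inverse.to (glued↔₂ iso (orig (to p₂ b))))
                       (map⁻ (subst (All G) e ys))
    convert*-glued {[]}     {[]}     refl []       = refl
    convert*-glued {a ∷ as} {b ∷ bs} e    (y ∷ ys) rewrite subst-∷ {C = G} e y ys =
      cong₂ _∷_ (shared-glued (∷-injectiveˡ e) y) (convert*-glued (∷-injectiveʳ e) ys)

  -- The two reducts of the glued model.

  module _ {S₁ S₂ : Signature ℓ} {M₁ : Model S₁} {M₂ : Model S₂} (G : Gluable M₁ M₂) where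

    private
      C = combinable G

    gluedApp-≐₁ : ∀ {σ} (o : Origin (q₁ C) (q₂ C) (to (q₁ C) σ)) as →
                  cast (paramsᶜ-≡₁ C o) (returnᶜ-≡₁ C o) (gluedApp G o) as ≐
                  Inverse.to (carrier↔₁ G) ⊢
                    appᴹ M₁ σ (All.map (Inverse.to (carrier↔₁ G)) (map⁻ as))
    -- The scrutinee is the very proof inside `paramsᶜ-≡₁` and `returnᶜ-≡₁`, so matching it also
    -- makes `cast` compute.
    gluedApp-≐₁ {σ} (fst σ′ eq) as with just-injective (trans (sym eq) (from-to (q₁ C) σ))
    ... | refl = ≐-refl
    gluedApp-≐₁ {σ} (snd σ′ eq _) as with trans (sym (from-to (q₁ C) σ)) eq
    ... | ()

    gluedApp-≐₂ : ∀ {σ} (o : Origin (q₁ C) (q₂ C) (to (q₂ C) σ)) as →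
                  cast (paramsᶜ-≡₂ C o) (returnᶜ-≡₂ C o) (gluedApp G o) as ≐
                  Inverse.to (carrier↔₂ G) ⊢
                    appᴹ M₂ σ (All.map (Inverse.to (carrier↔₂ G)) (map⁻ as))
    -- A shared symbol takes its operation from `M₁`; `app-agree` relates it to that of `M₂`, and
    -- coherence identifies the converted arguments and element with the direct projections.
    gluedApp-≐₂ {σ} (fst σ₁ eq) = cast-≐ ps r λ xs {x} →
      let f , g = app-agree G eq e₂ (All.map (Inverse.to (carrier↔₁ G)) (map⁻ xs))
          xs≡   = convert*-glued (p₁ C) (p₂ C) (carrier-iso G) (sortOrigin C) ps xs
          x≡    = shared-glued (p₁ C) (p₂ C) (carrier-iso G) (sortOrigin C) r x
      in (λ h → subst id (cong₂ (appᴹ M₂ σ) xs≡ x≡) (f h)) ,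
         (λ h → g (subst id (sym (cong₂ (appᴹ M₂ σ) xs≡ x≡)) h))
      where
      e₂ = from-to (q₂ C) σ
      ps = params-agree C eq e₂
      r  = return-agree C eq e₂
    gluedApp-≐₂ {σ} (snd σ′ _ eq) as with just-injective (trans (sym eq) (from-to (q₂ C) σ))
    ... | refl = ≐-refl

    reduct₁ : Reduct (inclusion₁ C) {M₁} {glueM G}
    reduct₁ = record
      { carrier = carrier↔₁ G
      ; app-≐   = λ σ → gluedApp-≐₁ (symbOrigin C (to (q₁ C) σ))
      }

    reduct₂ : Reduct (inclusion₂ C) {M₂} {glueM G}
    reduct₂ = record
      { carrier = carrier↔₂ G
      ; app-≐   = λ σ → gluedApp-≐₂ (symbOrigin C (to (q₂ C) σ))
      }

proposition5 : ∀ {ℓ : Level} (em : ExcludedMiddle (suc ℓ)) →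
    let open Semantics em in
    {Σ₁ Σ₂ : Signature ℓ} (M₁ : Model Σ₁) (M₂ : Model Σ₂)
    (Γ₁ : Theory Σ₁) (Γ₂ : Theory Σ₂) (G : Gluable M₁ M₂) →
    M₁ ⊨ Γ₁ → M₂ ⊨ Γ₂ →
    glueM G ⊨ combineT (Gluable.combinable G) Γ₁ Γ₂
-- Only the inclusion of the full carrier has content: validity of `φ` at the restricted valuation
-- covers the image in `M₁` of every glued element.
proposition5 em M₁ M₂ Γ₁ Γ₂ G h₁ h₂ (inj₁ ((s , φ) , φ∈ , refl)) ρ =
  (λ _ → tt) ,
  λ _ → proj₂ (⟦translate⟧ em _ (reduct₁ em G) φ ρ)
          (proj₂ (h₁ φ∈ (restrict em _ (reduct₁ em G) ρ)) tt)
proposition5 em M₁ M₂ Γ₁ Γ₂ G h₁ h₂ (inj₂ ((s , φ) , φ∈ , refl)) ρ =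
  (λ _ → tt) ,
  λ _ → proj₂ (⟦translate⟧ em _ (reduct₂ em G) φ ρ)
          (proj₂ (h₂ φ∈ (restrict em _ (reduct₂ em G) ρ)) tt)
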